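{- For every definitive set $X \in \mathcal{D}$ and every linear-time temporal property $P \subseteq \Sigma^\omega$: $$\mathrm{Pr}(X) = P \quad\text{if and only if}\quad X = \mathrm{Df}(P).$$
   Context: Fix a set $A$ of atomic propositions and let $\Sigma = \mathcal{P}(A)$ be the set of states. $\Sigma^*$ is the set of finite traces (finite sequences of states, including the empty trace $\varepsilon$), $\Sigma^\omega$ the set of infinite traces, and $\Sigma^\infty = \Sigma^* \cup \Sigma^\omega$. Traces $t,u$ are concatenated as $tu$, with $tu = t$ if $t$ is infinite. For $X \subseteq \Sigma^\infty$, $\downarrow X = \{u \mid \exists t \in X.\ \exists v \in \Sigma^\infty.\ t = uv\}$ is the set of prefixes of traces in $X$; for a trace $t$, $\uparrow t = \{tu \mid u \in \Sigma^\infty\}$ is its set of extensions. The set of definitive prefixes of $X\subseteq\Sigma^\infty$ is $\mathrm{dp}(X) = \{t \in \Sigma^\infty \mid \uparrow t \subseteq \downarrow X\}$. A set $X \subseteq \Sigma^\infty$ is definitive iff $X = \mathrm{dp}(X)$; $\mathcal{D}$ denotes the set of all definitive sets. A linear-time temporal property is a subset of $\Sigma^\omega$. The maps $\mathrm{Pr} : \mathcal{D} \to \mathcal{P}(\Sigma^\omega)$ and $\mathrm{Df} : \mathcal{P}(\Sigma^\omega) \to \mathcal{D}$ are defined by $\mathrm{Pr}(X) = X \cap \Sigma^\omega$ and $\mathrm{Df}(P) = \mathrm{dp}(P)$ (the set $\mathrm{dp}(P)$ is always definitive). -}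

module Defs where

open import Data.List using (List; []; _∷_; _++_)
open import Data.List.Properties using (++-assoc; ++-identityʳ)
import Data.List.Relation.Binary.Pointwise as Listwise
open import Data.Nat using (ℕ; zero; suc)
open import Data.Product using (∃-syntax; _×_; _,_; proj₁; proj₂)
open import Data.Sum using (_⊎_; inj₁; inj₂)
open import Data.Sum.Relation.Binary.Pointwise using (_⊎ₛ_; inj₁; inj₂)
import Level as L
open import Relation.Binary using (Setoid; IsEquivalence; _Respects_)
open import Relation.Binary.PropositionalEquality using (_≡_; refl)
open import Relation.Unary using (Pred; _∈_; _⊆_; _∩_; _≐_)
open import Relation.Unary.Properties using (≐-refl; ≐-sym; ≐-trans)
open import Relation.Unary.Relation.Binary.Equality using (≐-setoid)

module LinearTime {a} (A : Set a) where

  State : Set (L.suc a)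
  State = Pred A a

  FiniteTrace : Set (L.suc a)
  FiniteTrace = List State

  InfiniteTrace : Set (L.suc a)
  InfiniteTrace = ℕ → State

  Trace : Set (L.suc a)
  Trace = FiniteTrace ⊎ InfiniteTrace

  -- Equality of traces: same length, and extensionally equal states at each
  -- position.  (Propositional equality would be too fine, as neither functions
  -- nor propositions are extensional here.)

  infiniteTraceSetoid : Setoid (L.suc a) a
  infiniteTraceSetoid = record
    { Carrier       = InfiniteTrace
    ; _≈_           = λ s t → ∀ n → s n ≐ t n
    ; isEquivalence = record
      { refl  = λ _ → ≐-refl
      ; sym   = λ s≈t n → ≐-sym (s≈t n)
      ; trans = λ s≈t t≈u n → ≐-trans (s≈t n) (t≈u n)
      }
    }

  traceSetoid : Setoid (L.suc a) (L.suc a)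
  traceSetoid = Listwise.setoid (≐-setoid A a) ⊎ₛ infiniteTraceSetoid

  open Setoid traceSetoid public
    using (_≈_)
    renaming (refl to ≈-refl; reflexive to ≈-reflexive; sym to ≈-sym; trans to ≈-trans)

  infixr 6 _++ω_ _·_

  _++ω_ : FiniteTrace → InfiniteTrace → InfiniteTrace
  ([]      ++ω s) n       = s n
  ((x ∷ w) ++ω s) zero    = x
  ((x ∷ w) ++ω s) (suc n) = (w ++ω s) n

  _·_ : Trace → Trace → Trace
  inj₁ w · inj₁ w′ = inj₁ (w ++ w′)
  inj₁ w · inj₂ s  = inj₂ (w ++ω s)
  inj₂ s · _       = inj₂ s

  ε : Trace
  ε = inj₁ []

  TraceSet : Set (L.suc (L.suc a))
  TraceSet = Pred Trace (L.suc a)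

  data Σω : TraceSet where
    infinite : ∀ s → Σω (inj₂ s)

  infix 8 ↓_ ↑_

  ↓_ : TraceSet → TraceSet
  (↓ X) u = ∃[ t ] t ∈ X × (∃[ v ] t ≈ u · v)

  ↑_ : Trace → TraceSet
  (↑ t) u = ∃[ v ] u ≈ t · v

  dp : TraceSet → TraceSet
  dp X t = ↑ t ⊆ ↓ X

  -- A definitive set needs no separate requirement to respect _≈_: this
  -- follows from the equation, since dp X always respects _≈_.
  record 𝒟 : Set (L.suc (L.suc a)) where
    field
      traces     : TraceSet
      definitive : traces ≐ dp traces

  record Property : Set (L.suc (L.suc a)) where
    field
      traces  : TraceSet
      resp-≈  : traces Respects _≈_
      ⊆Σω     : traces ⊆ Σω

  ++ω-congˡ : ∀ {w w′} s → Listwise.Pointwise _≐_ w w′ → ∀ n → (w ++ω s) n ≐ (w′ ++ω s) n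
  ++ω-congˡ s Listwise.[]         n       = ≐-refl
  ++ω-congˡ s (x≐y Listwise.∷ eq) zero    = x≐y
  ++ω-congˡ s (x≐y Listwise.∷ eq) (suc n) = ++ω-congˡ s eq n

  ++ω-assoc : ∀ w w′ s n → ((w ++ w′) ++ω s) n ≡ (w ++ω (w′ ++ω s)) n
  ++ω-assoc []      w′ s n       = refl
  ++ω-assoc (x ∷ w) w′ s zero    = refl
  ++ω-assoc (x ∷ w) w′ s (suc n) = ++ω-assoc w w′ s n

  ·-congˡ : ∀ {t t′} u → t ≈ t′ → t · u ≈ t′ · u
  ·-congˡ (inj₁ w) (inj₁ eq) = inj₁ (Listwise.++⁺ eq (Listwise.refl ≐-refl))
  ·-congˡ (inj₂ s) (inj₁ eq) = inj₂ (++ω-congˡ s eq)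
  ·-congˡ u        (inj₂ eq) = inj₂ eq

  ·-identityʳ : ∀ t → t · ε ≈ t
  ·-identityʳ (inj₁ w) = inj₁ (S.reflexive (++-identityʳ w))
    where module S = Setoid (Listwise.setoid (≐-setoid A a))
  ·-identityʳ (inj₂ s) = ≈-refl

  ·-assoc : ∀ t u v → (t · u) · v ≈ t · (u · v)
  ·-assoc (inj₁ w) (inj₁ w′) (inj₁ w″) = inj₁ (S.reflexive (++-assoc w w′ w″))
    where module S = Setoid (Listwise.setoid (≐-setoid A a))
  ·-assoc (inj₁ w) (inj₁ w′) (inj₂ s)  = inj₂ λ n → S.reflexive (++ω-assoc w w′ s n)
    where module S = Setoid (≐-setoid A a)
  ·-assoc (inj₁ w) (inj₂ s)  v         = ≈-refl
  ·-assoc (inj₂ s) u         v         = ≈-refl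

  dp-resp-≈ : ∀ X → dp X Respects _≈_
  dp-resp-≈ X t≈t′ t∈dpX (v , u≈t′v) =
    t∈dpX (v , ≈-trans u≈t′v (·-congˡ v (≈-sym t≈t′)))

  dp-definitive : ∀ X → dp X ≐ dp (dp X)
  dp-definitive X = to , from
    where
    to : dp X ⊆ dp (dp X)
    to {t} t∈dpX {u} (v , u≈tv) = u , u∈dpX , ε , ≈-sym (·-identityʳ u)
      where
      u∈dpX : u ∈ dp X
      u∈dpX (w , x≈uw) =
        t∈dpX (v · w , ≈-trans x≈uw (≈-trans (·-congˡ w u≈tv) (·-assoc t v w)))

    from : dp (dp X) ⊆ dp X
    from t∈dpdpX {u} u∈↑t
      with t∈dpdpX u∈↑t
    ... | s , s∈dpX , v , s≈uv
      with s∈dpX (ε , ≈-sym (·-identityʳ s))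
    ... | r , r∈X , w , r≈sw =
      r , r∈X , v · w , ≈-trans r≈sw (≈-trans (·-congˡ w s≈uv) (·-assoc u v w))

  Pr : 𝒟 → Property
  Pr X = record
    { traces = traces ∩ Σω
    ; resp-≈ = resp
    ; ⊆Σω    = λ (_ , t∈Σω) → t∈Σω
    }
    where
    open 𝒟 X
    resp : (traces ∩ Σω) Respects _≈_
    resp t≈t′@(inj₂ {d = s′} _) (t∈X , infinite _) =
      proj₂ definitive (dp-resp-≈ traces t≈t′ (proj₁ definitive t∈X)) , infinite s′

  Df : Property → 𝒟
  Df P = record
    { traces     = dp traces
    ; definitive = dp-definitive traces
    }
    where open Property P

{-# OPTIONS --safe #-}

-- A definitive set and its infinite part have the same prefixes, since every
-- trace of a definitive set extends to an infinite one in the set; dp depends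
-- only on prefixes, so X = dp X = dp (X ∩ Σω).  Conversely, an infinite trace
-- has no extension but itself, so dp P and P have the same infinite traces.
module Submission where

open import Data.Product using (_,_; proj₁)
open import Data.Sum using (inj₁; inj₂)
open import Data.Sum.Relation.Binary.Pointwise using (inj₂)
open import Defs
open import Function.Bundles using (_⇔_; mk⇔)
open import Relation.Binary using (_Respects_)
open import Relation.Unary using (_≐_; _∈_; _⊆_; _∩_)
open import Relation.Unary.Polymorphic using (∅)
open import Relation.Unary.Properties using (≐-trans)

module _ {a} {A : Set a} where
  open LinearTime A

  -- An arbitrary choice: any infinite trace would serve to extend finite ones.
  ∅ω : Trace
  ∅ω = inj₂ λ _ → ∅

  Σω-resp-≈ : Σω Respects _≈_
  Σω-resp-≈ (inj₂ _) (infinite _) = infinite _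

  ·∅ω∈Σω : ∀ t → t · ∅ω ∈ Σω
  ·∅ω∈Σω (inj₁ _) = infinite _
  ·∅ω∈Σω (inj₂ _) = infinite _

  ·-identityʳ-Σω : ∀ {t} v → t ∈ Σω → t · v ≈ t
  ·-identityʳ-Σω v (infinite _) = ≈-refl

  ↓-↓-closed : ∀ X Y → X ⊆ ↓ Y → ↓ X ⊆ ↓ Y
  ↓-↓-closed _ _ X⊆↓Y {u} (t , t∈X , v , t≈uv) with X⊆↓Y t∈X
  ... | r , r∈Y , w , r≈tw =
    r , r∈Y , v · w , ≈-trans r≈tw (≈-trans (·-congˡ w t≈uv) (·-assoc u v w))

  -- Assuming only `X ⊆ ↓ Y` lets this apply with `Y = X ∩ Σω`, which may omit the finite traces of
  -- `X`.
  dp-mono : ∀ X Y → X ⊆ ↓ Y → dp X ⊆ dp Y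
  dp-mono X Y X⊆↓Y t∈dpX u∈↑t = ↓-↓-closed X Y X⊆↓Y (t∈dpX u∈↑t)

  ⊆⇒⊆↓ : ∀ (X Y : TraceSet) → X ⊆ Y → X ⊆ ↓ Y
  ⊆⇒⊆↓ _ _ X⊆Y {t} t∈X = t , X⊆Y t∈X , ε , ≈-sym (·-identityʳ t)

  -- The extension `t · ∅ω` is a prefix of some `r ∈ X`; being infinite, it equals `r`, so `r` is an
  -- infinite trace of `X` extending `t`.
  dp⊆↓∩Σω : ∀ X → dp X ⊆ ↓ (X ∩ Σω)
  dp⊆↓∩Σω X {t} t∈dpX with t∈dpX (∅ω , ≈-refl)
  ... | r , r∈X , v , r≈t∅v =
    r , (r∈X , Σω-resp-≈ (≈-sym r≈t∅) (·∅ω∈Σω t)) , ∅ω , r≈t∅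
    where
    r≈t∅ : r ≈ t · ∅ω
    r≈t∅ = ≈-trans r≈t∅v (·-identityʳ-Σω v (·∅ω∈Σω t))

  definitive⇒≐dp∩Σω : ∀ X → X ≐ dp X → X ≐ dp (X ∩ Σω)
  definitive⇒≐dp∩Σω X (X⊆dpX , dpX⊆X) =
    (λ t∈X → dp-mono X (X ∩ Σω) (λ u∈X → dp⊆↓∩Σω X (X⊆dpX u∈X)) (X⊆dpX t∈X)) ,
    (λ t∈dp → dpX⊆X (dp-mono (X ∩ Σω) X (⊆⇒⊆↓ (X ∩ Σω) X proj₁) t∈dp))

  dp-cong : ∀ X Y → X ≐ Y → dp X ≐ dp Y
  dp-cong X Y (X⊆Y , Y⊆X) =
    dp-mono X Y (⊆⇒⊆↓ X Y X⊆Y) , dp-mono Y X (⊆⇒⊆↓ Y X Y⊆X)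

  dp∩Σω≐ : ∀ (P : Property) → let open Property P in dp traces ∩ Σω ≐ traces
  dp∩Σω≐ P = to , from
    where
    open Property P

    to : dp traces ∩ Σω ⊆ traces
    -- As an extension of itself, `t` is a prefix of some `r ∈ P`, and `t` infinite forces `r ≈ t`.
    to {t} (t∈dpP , t∈Σω) with t∈dpP (ε , ≈-sym (·-identityʳ t))
    ... | r , r∈P , v , r≈tv = resp-≈ (≈-trans r≈tv (·-identityʳ-Σω v t∈Σω)) r∈P

    from : traces ⊆ dp traces ∩ Σω
    from {t} t∈P = t∈dpP , ⊆Σω t∈P
      where
      t∈dpP : t ∈ dp traces
      -- Since `t` is infinite, `u ≈ t`, so `t` itself witnesses `u ∈ ↓ P`.
      t∈dpP {u} (v , u≈tv) =
        t , t∈P , ε ,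
        ≈-sym (≈-trans (·-identityʳ u) (≈-trans u≈tv (·-identityʳ-Σω v (⊆Σω t∈P))))

theorem2 : ∀ {a} (A : Set a) → let open LinearTime A in
    (X : 𝒟) (P : Property) →
    (Property.traces (Pr X) ≐ Property.traces P) ⇔ (𝒟.traces X ≐ 𝒟.traces (Df P))
theorem2 A X P = mk⇔
  (λ PrX≐P → ≐-trans
    (definitive⇒≐dp∩Σω traces definitive)
    (dp-cong (traces ∩ Σω) (Property.traces P) PrX≐P))
  -- Intersecting both sides with `Σω` reduces the claim to `dp∩Σω≐`.
  (λ (X⊆dpP , dpP⊆X) → ≐-trans
    ( (λ (t∈X , t∈Σω) → X⊆dpP t∈X , t∈Σω)
    , (λ (t∈dpP , t∈Σω) → dpP⊆X t∈dpP , t∈Σω))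
    (dp∩Σω≐ P))
  where
  open LinearTime A
  open 𝒟 X
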